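{- Let $n \geq 2$ be a positive integer. There exists a $\chi_{ig}^{AB}$-upper-game-vertex-critical graph $G$ such that $$\left\{\chi_{ig}^{AB}(G)-\chi_{ig}^{AB}(G-x) \, | \, x \in V(G)\right\}=\{ -1,-2n+3\}.$$
   Context: All graphs are simple, undirected and finite. The AB-independence coloring game on a graph $G$ is played by Alice and Bob in rounds, round $i$ being played with color $i$ ($i=1,2,\ldots$). Within a round the players alternate moves, each move consisting of coloring a previously uncolored vertex with the color of the round so that the vertices colored in the same round form an independent set. A round is completed when no uncolored vertex can be given the color of the round (every uncolored vertex is adjacent to a vertex colored in this round). The game is over when all vertices are colored. Alice starts the first round and each further round is started by the player who did not make the last move of the previous round. Alice wants to finish in as few rounds as possible, Bob in as many rounds as possible. The number of rounds when both players play optimally is the AB-independence game chromatic number $\chi_{ig}^{AB}(G)$. For $x\in V(G)$, $G-x$ is the graph obtained from $G$ by deleting $x$ and all edges incident with $x$. A graph $G$ is $\chi_{ig}^{AB}$-upper-game-vertex-critical if $\chi_{ig}^{AB}(G-x)>\chi_{ig}^{AB}(G)$ for every $x\in V(G)$. -}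

module Defs where

open import Data.Bool.Base using (if_then_else_)
open import Data.Fin.Base using (Fin; punchIn)
open import Data.Fin.Properties using (all?)
open import Data.List.Base using (List; []; _∷_; allFin; filter; map; null)
open import Data.List.Extrema.Nat using (min; max)
open import Data.Maybe.Base using (Maybe; just; nothing)
open import Data.Maybe.Properties using (≡-dec)
open import Data.Nat.Base using (ℕ; zero; suc; pred; _>_)
open import Data.Nat.Properties using (_≟_)
open import Data.Product.Base using (_×_)
open import Data.Vec.Base using (Vec; lookup; replicate; _[_]≔_)
open import Function.Base using (_∘_)
open import Level using (0ℓ)
open import Relation.Binary.Core using (Rel)
open import Relation.Binary.Definitions using (Decidable; Irreflexive; Symmetric)
open import Relation.Binary.PropositionalEquality.Core using (_≡_; cong)
open import Relation.Nullary.Decidable using (Dec; ¬?; _×-dec_; _→-dec_)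
open import Relation.Nullary.Negation.Core using (¬_)

record Graph (n : ℕ) : Set₁ where
  field
    Adj    : Rel (Fin n) 0ℓ
    adj?   : Decidable Adj
    sym    : Symmetric Adj
    irrefl : Irreflexive _≡_ Adj

infixl 6 _-ᵛ_

-- The remaining vertices are renumbered in increasing order.
_-ᵛ_ : ∀ {n} → Graph n → Fin n → Graph (pred n)
_-ᵛ_ {suc n} G x = record
  { Adj    = λ u v → Adj (punchIn x u) (punchIn x v)
  ; adj?   = λ u v → adj? (punchIn x u) (punchIn x v)
  ; sym    = sym
  ; irrefl = irrefl ∘ cong (punchIn x)
  }
  where open Graph G

data Player : Set where
  Alice Bob : Player

opponent : Player → Player
opponent Alice = Bob
opponent Bob   = Alice

-- The empty list is a dummy case: `value` below never uses it in play from
-- the initial position.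
optimal : Player → List ℕ → ℕ
optimal _     []       = 0
optimal Alice (v ∷ vs) = min v vs
optimal Bob   (v ∷ vs) = max v vs

-- `nothing` marks an uncolored vertex.
Coloring : ℕ → Set
Coloring n = Vec (Maybe ℕ) n

module Game {n : ℕ} (G : Graph n) where
  open Graph G

  -- In round i the vertex v may be given color i.
  Legal : ℕ → Coloring n → Fin n → Set
  Legal i c v = lookup c v ≡ nothing × (∀ w → lookup c w ≡ just i → ¬ Adj v w)

  legal? : ∀ i c v → Dec (Legal i c v)
  legal? i c v =
    ≡-dec _≟_ (lookup c v) nothing ×-dec
    all? (λ w → ≡-dec _≟_ (lookup c w) (just i) →-dec ¬? (adj? v w))

  moves : ℕ → Coloring n → List (Fin n)
  moves i c = filter (legal? i c) (allFin n)

  -- The round of the next move: round i, unless it is completed.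
  round : ℕ → Coloring n → ℕ
  round i c = if null (moves i c) then suc i else i

  -- value p k i c is the total number of rounds under optimal play when k
  -- vertices are still uncolored in c, player p is to move and the latest
  -- round is i.  Each move colors exactly one vertex, so k moves remain.
  -- As a new round is started by the player who did not make the last move,
  -- the players alternate throughout the whole game.
  value : Player → ℕ → ℕ → Coloring n → ℕ
  value p zero    i c = i
  value p (suc k) i c =
    optimal p (map (λ v → value (opponent p) k j (c [ v ]≔ just j)) (moves j c))
    where j = round i c

-- The graph without vertices needs no round.
χ : ∀ {n} → Graph n → ℕ
χ {zero}  G = 0
χ {suc n} G = Game.value G Alice (suc n) 1 (replicate (suc n) nothing)

UpperGameVertexCritical : ∀ {n} → Graph n → Set
UpperGameVertexCritical G = ∀ x → χ (G -ᵛ x) > χ G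

{-# OPTIONS --safe #-}
module Submission where

-- A crown of size q is K_{q,q} minus a perfect matching.  The witness is the
-- join of a vertex (the apex), a crown of size 3 and a crown of size 2n-1.
-- As every round stays inside one part of the join, what matters is who has to
-- open a crown.  If Bob opens it, Alice answers on the same side and the crown
-- takes 2 rounds; if Alice opens it, Bob answers with the matched vertex and,
-- repeating this, makes every matched pair a round of its own.  With all
-- vertices present Alice takes the apex first, and by parity Bob has to open
-- both crowns: 5 rounds.  After deleting a vertex parity favors Bob in every
-- undamaged crown, while a damaged crown takes 2 rounds, as Alice starts with
-- the former partner of the deleted vertex.  So deleting the apex gives
-- 3 + (2n-1) rounds, deleting from the small crown 1 + 2 + (2n-1), and deleting
-- from the large crown 1 + 2 + 3.

open import Defs
open import Data.Bool.Base using (Bool; true; false; not; _xor_; if_then_else_)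
open import Data.Bool.Properties as Bool using (not-involutive; not-¬; ¬-not; xor-same)
open import Data.Empty using (⊥; ⊥-elim)
open import Data.Fin.Base as Fin
  using (Fin; zero; suc; toℕ; fromℕ<; _↑ˡ_; _↑ʳ_; splitAt; punchIn; punchOut)
open import Data.Fin.Properties as Fin
  using (any?; ¬∀⟶∃¬; pigeonhole; toℕ<n; toℕ-fromℕ<; splitAt-↑ˡ; splitAt-↑ʳ; splitAt⁻¹-↑ˡ;
    splitAt⁻¹-↑ʳ; punchIn-injective; punchIn-punchOut; punchInᵢ≢i)
open import Data.Integer.Base using (ℤ; +_; -_; _+_; _-_; _*_; -1ℤ; -[1+_])
import Data.Integer.Properties as ℤ
open import Data.List.Base using ([]; _∷_; allFin)
open import Data.List.Extrema.Nat using (min≤v⁺; v≤min⁺; max≤v⁺; v≤max⁺)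
open import Data.List.Membership.Propositional using (_∈_; lose)
open import Data.List.Membership.Propositional.Properties using (∈-filter⁺; ∈-filter⁻; ∈-allFin; ∈-map⁺)
open import Data.List.Relation.Unary.All as All using (All; _∷_)
import Data.List.Relation.Unary.All.Properties as All
open import Data.List.Relation.Unary.Any using (Any; here; there)
import Data.List.Relation.Unary.Any.Properties as Any
open import Data.Maybe.Base using (just; nothing)
open import Data.Maybe.Properties using (just-injective; ≡-dec)
open import Data.Nat.Base as ℕ using (ℕ; zero; suc; _≤_; _<_; z≤n; s≤s)
open import Data.Nat.Properties
  using (_≟_; _≤?_; ≤-refl; ≤-trans; ≤-antisym; <-irrefl; <⇒≢; n≤1+n; ≮⇒≥; ≰⇒>;
    m≤n⇒m<n∨m≡n; suc-injective; <-cmp; +-suc; m≤m+n; *-distribˡ-+)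
open import Data.Product.Base using (Σ-syntax; ∃-syntax; ∃; _×_; _,_; proj₁; proj₂)
open import Data.Sum.Base using (_⊎_; inj₁; inj₂; [_,_]′)
open import Data.Unit.Base using (⊤)
open import Data.Vec.Base using ([]; _∷_; lookup; replicate; _[_]≔_)
open import Data.Vec.Properties using (lookup∘update; lookup∘update′; lookup-replicate)
open import Function.Base using (_∘_; case_of_; const)
open import Relation.Binary.Definitions using (tri<; tri≈; tri>)
open import Relation.Binary.PropositionalEquality using (_≡_; _≢_; refl; sym; trans; cong; cong₂; subst)
open import Relation.Nullary using (¬_; Dec; yes; no; contradiction)
open import Relation.Nullary.Decidable
  using (does; dec-true; dec-false; decidable-stable; ¬?; _×-dec_; _→-dec_)
open import Relation.Unary using (Decidable; _≐_; _∪_; ｛_｝)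

-- Parity and the number of uncolored vertices.

data Even : ℕ → Set where
  even-zero : Even 0
  even-2+   : ∀ {n} → Even n → Even (suc (suc n))

even-double : ∀ n → Even (n ℕ.+ n)
even-double zero    = even-zero
even-double (suc n) = subst Even (cong suc (sym (+-suc n n))) (even-2+ (even-double n))

even⇒¬even-suc : ∀ {n} → Even n → ¬ Even (suc n)
even⇒¬even-suc even-zero   ()
even⇒¬even-suc (even-2+ e) (even-2+ e′) = even⇒¬even-suc e e′

uncolored : ∀ {n} → Coloring n → ℕ
uncolored []            = 0
uncolored (nothing ∷ c) = suc (uncolored c)
uncolored (just _  ∷ c) = uncolored c

uncolored-replicate : ∀ n → uncolored (replicate n nothing) ≡ n
uncolored-replicate zero    = refl
uncolored-replicate (suc n) = cong suc (uncolored-replicate n)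

uncolored-update : ∀ {n} (c : Coloring n) v {j} → lookup c v ≡ nothing →
                   uncolored c ≡ suc (uncolored (c [ v ]≔ just j))
uncolored-update (nothing ∷ c) zero    _ = refl
uncolored-update (nothing ∷ c) (suc v) e = cong suc (uncolored-update c v e)
uncolored-update (just _  ∷ c) (suc v) e = uncolored-update c v e

∃-uncolored : ∀ {n k} (c : Coloring n) → uncolored c ≡ suc k → ∃ λ v → lookup c v ≡ nothing
∃-uncolored (nothing ∷ c) _ = zero , refl
∃-uncolored (just _  ∷ c) e = let v , p = ∃-uncolored c e in suc v , p

colored : ∀ {n} (c : Coloring n) → uncolored c ≡ 0 → ∀ v → ∃ λ t → lookup c v ≡ just t
colored (just t ∷ c) _ zero    = t , refl
colored (just _ ∷ c) e (suc v) = colored c e v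

module _ {n} (c : Coloring n) (v : Fin n) {j : ℕ} where

  lookup-update : ∀ {w t} → lookup (c [ v ]≔ just j) w ≡ just t →
                  (w ≡ v × t ≡ j) ⊎ (w ≢ v × lookup c w ≡ just t)
  lookup-update {w} e with w Fin.≟ v
  ... | yes refl = inj₁ (refl , sym (just-injective (trans (sym (lookup∘update w c _)) e)))
  ... | no  w≢v  = inj₂ (w≢v , trans (sym (lookup∘update′ w≢v c _)) e)

  uncolored-before : ∀ {w} → lookup (c [ v ]≔ just j) w ≡ nothing → w ≢ v × lookup c w ≡ nothing
  uncolored-before {w} e with w Fin.≟ v
  ... | yes refl = case trans (sym (lookup∘update w c _)) e of λ ()
  ... | no  w≢v  = w≢v , trans (sym (lookup∘update′ w≢v c _)) e

  colored-after : lookup c v ≡ nothing → ∀ {w t} →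
                  lookup c w ≡ just t → lookup (c [ v ]≔ just j) w ≡ just t
  colored-after cv {w} e with w Fin.≟ v
  ... | yes refl = case trans (sym cv) e of λ ()
  ... | no  w≢v  = trans (lookup∘update′ w≢v c _) e

-- The involution splits the uncolored vertices into pairs. Coloring one pair lowers their number by
-- two and leaves the other pairs intact.
even-uncolored : ∀ {n} (τ : Fin n → Fin n) → (∀ v → τ (τ v) ≡ v) →
  ∀ k (c : Coloring n) → uncolored c ≡ k →
  (∀ v → lookup c v ≡ nothing → τ v ≢ v × lookup c (τ v) ≡ nothing) → Even k
even-uncolored τ inv zero    c _ _ = even-zero
even-uncolored τ inv (suc k) c e h = helper k uncolored-c₂
  where
  v = proj₁ (∃-uncolored c e)
  cv = proj₂ (∃-uncolored c e)
  τv≢v = proj₁ (h v cv)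
  -- Color 0 is a dummy: only whether a vertex is colored matters here.
  c₁ = c [ v ]≔ just 0
  c₂ = c₁ [ τ v ]≔ just 0
  c₁τv : lookup c₁ (τ v) ≡ nothing
  c₁τv = trans (lookup∘update′ τv≢v c _) (proj₂ (h v cv))
  uncolored-c₂ : k ≡ suc (uncolored c₂)
  uncolored-c₂ = suc-injective (trans (sym e) (trans (uncolored-update c v cv)
    (cong suc (uncolored-update c₁ (τ v) c₁τv))))
  h₂ : ∀ w → lookup c₂ w ≡ nothing → τ w ≢ w × lookup c₂ (τ w) ≡ nothing
  h₂ w e₂ =
    let w≢τv , e₁ = uncolored-before c₁ (τ v) e₂
        w≢v , e₀ = uncolored-before c v e₁
        τw≢w , e₃ = h w e₀
    in τw≢w , trans (lookup∘update′ (λ τw≡τv → w≢v (trans (sym (inv w)) (trans (cong τ τw≡τv) (inv v)))) c₁ _)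
               (trans (lookup∘update′ (λ τw≡v → w≢τv (trans (sym (inv w)) (cong τ τw≡v))) c _) e₃)
  helper : ∀ k → k ≡ suc (uncolored c₂) → Even (suc k)
  helper (suc k′) e′ = even-2+ (even-uncolored τ inv k′ c₂ (sym (suc-injective e′)) h₂)

-- Bounds on the number of rounds that a player aims for.

Bound : Player → ℕ → ℕ → Set
Bound Alice r s = s ≤ r
Bound Bob   r s = r ≤ s

optimal-own : ∀ q {r xs} → Any (Bound q r) xs → Bound q r (optimal q xs)
optimal-own Alice {xs = x ∷ xs} (here p)  = min≤v⁺ x xs (inj₁ p)
optimal-own Alice {xs = x ∷ xs} (there p) = min≤v⁺ x xs (inj₂ p)
optimal-own Bob   {xs = x ∷ xs} (here p)  = v≤max⁺ x xs (inj₁ p)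
optimal-own Bob   {xs = x ∷ xs} (there p) = v≤max⁺ x xs (inj₂ p)

-- Here `p` chooses and `q` aims at the bound. The member `x` rules out the empty list, whose dummy
-- value 0 may violate a lower bound.
optimal-all : ∀ p q {r x xs} → x ∈ xs → All (Bound q r) xs → Bound q r (optimal p xs)
optimal-all Alice Alice x∈xs ps = optimal-own Alice (lose x∈xs (All.lookup ps x∈xs))
optimal-all Bob   Bob   x∈xs ps = optimal-own Bob   (lose x∈xs (All.lookup ps x∈xs))
optimal-all Alice Bob {xs = _ ∷ _} _ (p ∷ ps) = v≤min⁺ p ps
optimal-all Bob Alice {xs = _ ∷ _} _ (p ∷ ps) = max≤v⁺ p ps

opponent-involutive : ∀ p → opponent (opponent p) ≡ p
opponent-involutive Alice = refl
opponent-involutive Bob   = refl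

-- Positions of the game and legal moves.

module _ {n} (G : Graph n) where
  open Graph G renaming (sym to adj-sym)
  open Game G

  Move : ℕ → Coloring n → Fin n → Set
  Move i c v = Legal (round i c) c v

  play : ℕ → Coloring n → Fin n → Coloring n
  play i c v = c [ v ]≔ just (round i c)

  -- All that later arguments keep of the history of play. The field `current` is conditional
  -- because no vertex has color 1 before the opening move; at the end it ensures that the last
  -- round has used its color.
  record Position (k i : ℕ) (c : Coloring n) : Set where
    field
      started  : 0 < i
      count    : uncolored c ≡ k
      positive : ∀ {v t} → lookup c v ≡ just t → 0 < t
      bounded  : ∀ {v t} → lookup c v ≡ just t → t ≤ i
      proper   : ∀ {u v t} → lookup c u ≡ just t → lookup c v ≡ just t → ¬ Adj u v
      -- Vertices get the smallest color available: completed rounds have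
      -- maximal independent color classes.
      greedy   : ∀ {v t s} → lookup c v ≡ just t → 0 < s → s < t →
                 ∃ λ w → Adj v w × lookup c w ≡ just s
      blocked  : ∀ {v s} → lookup c v ≡ nothing → 0 < s → s < i →
                 ∃ λ w → Adj v w × lookup c w ≡ just s
      current  : ∀ {v t} → lookup c v ≡ just t → ∃ λ w → lookup c w ≡ just i

  initial : Position n 1 (replicate n nothing)
  initial = record
    { started  = s≤s z≤n
    ; count    = uncolored-replicate n
    ; positive = λ {v} → absurd v
    ; bounded  = λ {v} → absurd v
    ; proper   = λ {v} e → absurd v e
    ; greedy   = λ {v} e → absurd v e
    ; blocked  = λ { _ (s≤s z≤n) (s≤s ()) }
    ; current  = λ {v} → absurd v
    }
    where
    absurd : ∀ v {t} {A : Set} → lookup (replicate n nothing) v ≡ just t → A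
    absurd v e = case trans (sym (lookup-replicate v nothing)) e of λ ()

  module _ {k i c} (pos : Position k i c) where
    open Position pos

    fresh-legal : ∀ {v} → lookup c v ≡ nothing → Legal (suc i) c v
    fresh-legal cv = cv , λ w cw _ → <-irrefl refl (bounded cw)

    legal-round : ∀ {v} → Legal i c v → round i c ≡ i
    legal-round {v} leg with moves i c | ∈-filter⁺ (legal? i c) (∈-allFin v) leg
    ... | _ ∷ _ | _ = refl

    round-cases : (round i c ≡ i × ∃ (Legal i c)) ⊎ (round i c ≡ suc i × (∀ v → ¬ Legal i c v))
    round-cases with any? (legal? i c)
    ... | yes (v , leg) = inj₁ (legal-round leg , v , leg)
    ... | no ¬leg with moves i c in eq
    ...   | []    = inj₂ (refl , λ v leg → ¬leg (v , leg))
    ...   | v ∷ _ = ⊥-elim (¬leg (v , proj₂ (∈-filter⁻ (legal? i c) {xs = allFin n}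
                      (subst (v ∈_) (sym eq) (here refl)))))

    round≥ : i ≤ round i c
    round≥ with round-cases
    ... | inj₁ (e , _) rewrite e = ≤-refl
    ... | inj₂ (e , _) rewrite e = n≤1+n i

    round-blocked : ∀ {v s} → lookup c v ≡ nothing → 0 < s → s < round i c →
                    ∃ λ w → Adj v w × lookup c w ≡ just s
    round-blocked {v} {s} cv 0<s s<r with round-cases
    ... | inj₁ (e , _) rewrite e = blocked cv 0<s s<r
    ... | inj₂ (e , ¬leg) rewrite e with s<r
    ...   | s≤s s≤i with m≤n⇒m<n∨m≡n s≤i
    ...     | inj₁ s<i = blocked cv 0<s s<i
    -- As `v` is uncolored, only a neighbor of color `i` can make that color illegal; decidability
    -- extracts it.
    ...     | inj₂ refl =
      let w , ¬ok = ¬∀⟶∃¬ n _ ok? (λ ok → ¬leg v (cv , ok))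
      in w , decidable-stable (adj? v w) (λ ¬adj → ¬ok (λ _ → ¬adj))
           , decidable-stable (≡-dec _≟_ (lookup c w) (just i)) (λ ≢i → ¬ok (λ ≡i → ⊥-elim (≢i ≡i)))
      where
      ok? = λ w → ≡-dec _≟_ (lookup c w) (just i) →-dec ¬? (adj? v w)

  ∃-move : ∀ {k i c} → Position (suc k) i c → ∃ (Move i c)
  ∃-move {c = c} pos with round-cases pos
  ... | inj₁ (e , v , leg) rewrite e = v , leg
  ... | inj₂ (e , _) rewrite e =
    let v , cv = ∃-uncolored c (Position.count pos) in v , fresh-legal pos cv

  step : ∀ {k i c v} → Position (suc k) i c → Move i c v →
         Position k (round i c) (play i c v)
  step {k} {i} {c} {v} pos (cv , ok) = record
    { started  = 0<round
    ; count    = suc-injective (trans (sym (uncolored-update c v cv)) count)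
    ; positive = λ e → case lookup-update c v e of λ where
        (inj₁ (_ , refl)) → 0<round
        (inj₂ (_ , e′))   → positive e′
    ; bounded  = λ e → case lookup-update c v e of λ where
        (inj₁ (_ , refl)) → ≤-refl
        (inj₂ (_ , e′))   → ≤-trans (bounded e′) (round≥ pos)
    ; proper   = λ e₁ e₂ → case lookup-update c v e₁ , lookup-update c v e₂ of λ where
        (inj₁ (refl , _)    , inj₁ (refl , _))    → irrefl refl
        (inj₁ (refl , refl) , inj₂ (_ , e))       → ok _ e
        (inj₂ (_ , e)       , inj₁ (refl , refl)) → ok _ e ∘ adj-sym
        (inj₂ (_ , e)       , inj₂ (_ , e′))      → proper e e′
    ; greedy   = λ e 0<s s<t → case lookup-update c v e of λ where
        (inj₁ (refl , refl)) → lift (round-blocked pos cv 0<s s<t)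
        (inj₂ (_ , e′))      → lift (greedy e′ 0<s s<t)
    ; blocked  = λ e 0<s s<t → lift (round-blocked pos (proj₂ (uncolored-before c v e)) 0<s s<t)
    ; current  = λ _ → v , lookup∘update v c _
    }
    where
    open Position pos
    0<round = ≤-trans started (round≥ pos)
    lift : ∀ {u s} → (∃ λ w → Adj u w × lookup c w ≡ just s) →
           ∃ λ w → Adj u w × lookup (play i c v) w ≡ just s
    lift (w , a , e) = w , a , colored-after c v cv e

  opening-legal : ∀ v → Legal 1 (replicate n nothing) v
  opening-legal v = lookup-replicate v nothing , λ w cw →
    case trans (sym (lookup-replicate w nothing)) cw of λ ()

  opening-round : Fin n → round 1 (replicate n nothing) ≡ 1
  opening-round v = legal-round initial (opening-legal v)

  opening-move : ∀ v → Move 1 (replicate n nothing) v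
  opening-move v = subst (λ r → Legal r (replicate n nothing) v) (sym (opening-round v)) (opening-legal v)

  -- From strategies to bounds on the value.

  value-own : ∀ q {r k i c v} → Position (suc k) i c → Move i c v →
    Bound q r (value (opponent q) k (round i c) (play i c v)) → Bound q r (value q (suc k) i c)
  value-own q {i = i} {c} {v} pos leg b =
    optimal-own q (Any.map⁺ (lose (∈-filter⁺ (legal? (round i c) c) (∈-allFin v) leg) b))

  -- The mover `p` may be either player: a bound that survives every move holds no matter who
  -- chooses.
  value-all : ∀ p q {r k i c} → Position (suc k) i c →
    (∀ v → Move i c v → Bound q r (value (opponent p) k (round i c) (play i c v))) →
    Bound q r (value p (suc k) i c)
  value-all p q {k = k} {i = i} {c} pos b =
    let v , leg = ∃-move pos
        legal   = legal? (round i c) c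
        v∈      = ∈-filter⁺ legal (∈-allFin v) leg
    in optimal-all p q (∈-map⁺ (λ w → value (opponent p) k (round i c) (play i c w)) v∈)
         (All.map⁺ (All.tabulate λ {w} w∈ → b w (proj₂ (∈-filter⁻ legal {xs = allFin n} w∈))))


  -- For bounds that hold under arbitrary play once `Q` is secured.
  play-any : ∀ q {r} (Q : Coloring n → Set) →
    (∀ {i c} v → Q c → lookup c v ≡ nothing → Q (play i c v)) →
    (∀ {i c} → Position 0 i c → Q c → Bound q r i) →
    ∀ p {k i c} → Position k i c → Q c → Bound q r (value p k i c)
  play-any q Q keep end p {zero}  pos Qc = end pos Qc
  play-any q Q keep end p {suc k} pos Qc = value-all p q pos λ v leg →
    play-any q Q keep end (opponent p) (step pos leg) (keep v Qc (proj₁ leg))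

  -- Here `q` moves second. With an even number of vertices left, each move of the opponent leaves
  -- an odd number, so an answer is never lacking; `Q` has to hold only after the answers.
  play-reply : ∀ q {r} (Q : Coloring n → Set) →
    (∀ {k i c v} → Position (suc k) i c → Q c → Even (suc k) → Move i c v →
      ∃ λ u → Move (round i c) (play i c v) u ×
              Q (play (round i c) (play i c v) u)) →
    (∀ {i c} → Position 0 i c → Q c → Bound q r i) →
    ∀ {k} → Even k → ∀ {i c} → Position k i c → Q c → Bound q r (value (opponent q) k i c)
  play-reply q Q reply end even-zero pos Qc = end pos Qc
  play-reply q {r} Q reply end (even-2+ {k} e) {i} {c} pos Qc = value-all (opponent q) q pos λ v leg →
    let u , legal , Q′ = reply pos Qc (even-2+ e) leg
        pos₁ = step pos leg
    in subst (λ p → Bound q r (value p (suc k) _ _)) (sym (opponent-involutive q))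
         (value-own q pos₁ legal (play-reply q Q reply end e (step pos₁ legal) Q′))

  -- Finished colorings and the counting of colors.

  record Final (i : ℕ) : Set where
    field
      color      : Fin n → ℕ
      positive   : ∀ v → 0 < color v
      bounded    : ∀ v → color v ≤ i
      proper     : ∀ {u v} → Adj u v → color u ≢ color v
      greedy     : ∀ {u v} → color u < color v → ∃ λ w → Adj v w × color w ≡ color u
      -- A vertex is demanded because on the empty graph the round counter is 1 although no color is
      -- in use.
      surjective : Fin n → ∀ t → 0 < t → t ≤ i → ∃ λ v → color v ≡ t

    -- Colors run from 1 to `i`; shifted down by one they fit into `Fin i`, where more than `i` of
    -- them would collide.
    clique-bound : ∀ {r} (f : Fin r → Fin n) → (∀ {a b} → a Fin.< b → color (f a) ≢ color (f b)) → r ≤ i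
    clique-bound {r} f f-inj with r ≤? i
    ... | yes r≤i = r≤i
    ... | no  r≰i =
      let a , b , a<b , e = pigeonhole (≰⇒> r≰i) index in
      contradiction (trans (sym (toℕ-index a)) (trans (cong (suc ∘ toℕ) e) (toℕ-index b))) (f-inj a<b)
      where
      index : Fin r → Fin i
      index a with color (f a) | positive (f a) | bounded (f a)
      ... | suc t | _ | t<i = fromℕ< t<i
      toℕ-index : ∀ a → suc (toℕ (index a)) ≡ color (f a)
      toℕ-index a with color (f a) | positive (f a) | bounded (f a)
      ... | suc t | _ | t<i = cong suc (toℕ-fromℕ< t<i)

    -- All colors from 1 to `i` are in use. Were `i` greater than `r`, two of them would be
    -- represented by the same vertex of the list.
    cover-bound : ∀ {r} (f : Fin r → Fin n) → (∀ v → ∃ λ a → color (f a) ≡ color v) → Fin n → i ≤ r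
    cover-bound {r} f cover v₀ with i ≤? r
    ... | yes i≤r = i≤r
    ... | no  i≰r =
      let s , t , s<t , e = pigeonhole (≰⇒> i≰r) slot
      in contradiction
           (suc-injective (trans (sym (slot-color s)) (trans (cong (color ∘ f) e) (slot-color t))))
           (<⇒≢ s<t)
      where
      used : (t : Fin i) → ∃ λ v → color v ≡ suc (toℕ t)
      used t = surjective v₀ (suc (toℕ t)) (s≤s z≤n) (toℕ<n t)
      slot : Fin i → Fin r
      slot t = proj₁ (cover (proj₁ (used t)))
      slot-color : ∀ t → color (f (slot t)) ≡ suc (toℕ t)
      slot-color t = trans (proj₂ (cover (proj₁ (used t)))) (proj₂ (used t))

  module _ {i c} (pos : Position 0 i c) where
    private module P = Position pos

    final : Final i
    final = record
      { color      = color
      ; positive   = λ v → P.positive (color≡ v)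
      ; bounded    = λ v → P.bounded (color≡ v)
      ; proper     = λ {u} {v} a e → P.proper (color≡ u) (trans (color≡ v) (cong just (sym e))) a
      ; greedy     = λ {u} {v} u<v → unlift (P.greedy (color≡ v) (P.positive (color≡ u)) u<v)
      ; surjective = λ v t 0<t t≤i → onto (P.current (color≡ v)) 0<t (m≤n⇒m<n∨m≡n t≤i)
      }
      where
      color : Fin n → ℕ
      color v = proj₁ (colored c P.count v)
      color≡ : ∀ v → lookup c v ≡ just (color v)
      color≡ v = proj₂ (colored c P.count v)
      color-unique : ∀ {v t} → lookup c v ≡ just t → color v ≡ t
      color-unique {v} e = just-injective (trans (sym (color≡ v)) e)
      unlift : ∀ {v s} → (∃ λ w → Adj v w × lookup c w ≡ just s) → ∃ λ w → Adj v w × color w ≡ s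
      unlift (w , a , e) = w , a , color-unique e
      onto : ∀ {t} → (∃ λ w → lookup c w ≡ just i) → 0 < t → t < i ⊎ t ≡ i → ∃ λ v → color v ≡ t
      onto (w , e) _   (inj₂ refl) = w , color-unique e
      -- A smaller color occurs next to the vertex `w` of the last round, by `greedy`.
      onto (w , e) 0<t (inj₁ t<i)  = let u , _ , e′ = P.greedy e 0<t t<i in u , color-unique e′

    final-color : ∀ {v t} → lookup c v ≡ just t → Final.color final v ≡ t
    final-color {v} e = just-injective (trans (sym (proj₂ (colored c P.count v))) e)

    final-cong : ∀ {u v} → lookup c u ≡ lookup c v → Final.color final u ≡ Final.color final v
    final-cong {v = v} e = final-color (trans e (proj₂ (colored c P.count v)))

  -- If the round goes on, a vertex that can be colored is not adjacent to `v`, hence it is free. If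
  -- the round is completed, every uncolored vertex can open the next one; were none of them free,
  -- `τ` would pair them all, but after the move at `v` their number is odd.
  free-reply : ∀ {k i c v} → Position (suc k) i c → Even (suc k) → Move i c v →
    {Free : Fin n → Set} → Decidable Free → (τ : Fin n → Fin n) → (∀ w → τ (τ w) ≡ w) →
    (∀ w → lookup c w ≡ nothing → w ≢ v → ¬ Free w →
       Adj w v × τ w ≢ w × τ w ≢ v × lookup c (τ w) ≡ nothing) →
    ∃ λ u → Free u × Move (round i c) (play i c v) u
  free-reply {zero} _ ()
  free-reply {suc k} {i} {c} {v} pos even leg {Free} free? τ inv h = reply (round-cases pos₁)
    where
    j  = round i c
    c₁ = play i c v
    pos₁ = step pos leg
    not-free : ∀ {w} → lookup c₁ w ≡ nothing → ¬ Free w → Adj w v × τ w ≢ w × lookup c₁ (τ w) ≡ nothing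
    not-free {w} e ¬free =
      let w≢v , cw = uncolored-before c v e
          a , τw≢w , τw≢v , cτw = h w cw w≢v ¬free
      in a , τw≢w , trans (lookup∘update′ τw≢v c _) cτw
    reply : (round j c₁ ≡ j × ∃ (Legal j c₁)) ⊎ (round j c₁ ≡ suc j × (∀ u → ¬ Legal j c₁ u)) →
            ∃ λ u → Free u × Move j c₁ u
    reply (inj₁ (e , u , cu , ok)) with free? u
    ... | yes free = u , free , subst (λ r → Legal r c₁ u) (sym e) (cu , ok)
    ... | no ¬free = contradiction (proj₁ (not-free cu ¬free)) (ok v (lookup∘update v c _))
    reply (inj₂ (e , _)) with any? (λ u → ≡-dec _≟_ (lookup c₁ u) nothing ×-dec free? u)
    ... | yes (u , cu , free) = u , free , subst (λ r → Legal r c₁ u) (sym e) (fresh-legal pos₁ cu)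
    ... | no  none = contradiction even (even⇒¬even-suc
      (even-uncolored τ inv (suc k) c₁ (Position.count pos₁) λ w cw →
        proj₂ (not-free cw λ free → none (w , cw , free))))

  -- Lower bounds from cliques and from a pairing strategy of Bob.

  clique-lower : ∀ {r} (f : Fin r → Fin n) → (∀ {a b} → a Fin.< b → Adj (f a) (f b)) →
                 r ≤ value Alice n 1 (replicate n nothing)
  clique-lower f adj = play-any Bob (λ _ → ⊤) _
    (λ pos _ → Final.clique-bound (final pos) f (Final.proper (final pos) ∘ adj)) Alice initial _

  -- Bob answers v by τ v if v is moved by τ, and by a fixed point of τ otherwise.
  module _ (τ : Fin n → Fin n) (τ-involutive : ∀ v → τ (τ v) ≡ v) (τ-nonadjacent : ∀ v → ¬ Adj v (τ v))
           (τ-maximal : ∀ {v w} → τ v ≢ v → w ≢ v → w ≢ τ v → Adj v w ⊎ Adj v (τ w)) where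

    private
      Invariant : Coloring n → Set
      Invariant c = ∀ v → lookup c (τ v) ≡ lookup c v

      τ≢ : ∀ {v w} → w ≢ τ v → τ w ≢ v
      τ≢ {w = w} w≢τv e = w≢τv (trans (sym (τ-involutive w)) (cong τ e))

      color-fixed : ∀ c v {x} → τ v ≡ v → Invariant c → Invariant (c [ v ]≔ x)
      color-fixed c v τv≡v I w with w Fin.≟ v
      ... | yes refl rewrite τv≡v = refl
      ... | no w≢v = trans (lookup∘update′ (τ≢ (subst (w ≢_) (sym τv≡v) w≢v)) c _)
                       (trans (I w) (sym (lookup∘update′ w≢v c _)))

      color-pair : ∀ c v {x y} → τ v ≢ v → x ≡ y → Invariant c → Invariant ((c [ v ]≔ x) [ τ v ]≔ y)
      color-pair c v {x} τv≢v refl I w with w Fin.≟ v | w Fin.≟ τ v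
      ... | yes refl | _ = trans (lookup∘update (τ w) (c [ w ]≔ x) _)
                             (sym (trans (lookup∘update′ (τv≢v ∘ sym) (c [ w ]≔ x) _) (lookup∘update w c _)))
      ... | no _ | yes refl rewrite τ-involutive v =
        trans (lookup∘update′ (τv≢v ∘ sym) (c [ v ]≔ x) _)
          (trans (lookup∘update v c _) (sym (lookup∘update (τ v) (c [ v ]≔ x) _)))
      ... | no w≢v | no w≢τv =
        trans (trans (lookup∘update′ τw≢τv (c [ v ]≔ x) _)
                     (lookup∘update′ (τ≢ w≢τv) c _))
          (trans (I w) (sym (trans (lookup∘update′ w≢τv (c [ v ]≔ x) _) (lookup∘update′ w≢v c _))))
        where
        τw≢τv = λ e → w≢v (trans (sym (τ-involutive w)) (trans (cong τ e) (τ-involutive v)))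

      reply : ∀ {k i c v} → Position (suc k) i c → Invariant c → Even (suc k) → Move i c v →
        ∃ λ u → Move (round i c) (play i c v) u × Invariant (play (round i c) (play i c v) u)
      reply {i = i} {c} {v} pos I even leg@(cv , ok) with τ v Fin.≟ v
      -- An uncolored vertex moved by `τ` is adjacent to `v` or to `τ v`, which is `v` again. So
      -- `free-reply` applies with the fixed points as free vertices.
      ... | yes τv≡v =
        let u , τu≡u , legal = free-reply pos even leg (λ w → τ w Fin.≟ w) τ τ-involutive λ w cw w≢v τw≢w →
              let v≢τw = λ e → w≢v (trans (sym (τ-involutive w)) (trans (cong τ (sym e)) τv≡v))
              in [ (λ a → a) , subst (Adj w) τv≡v ]′ (τ-maximal τw≢w (w≢v ∘ sym) v≢τw)
                 , τw≢w , v≢τw ∘ sym , trans (I w) cw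
        in u , legal , color-fixed (play i c v) u τu≡u (color-fixed c v τv≡v I)
      -- The vertex `τ v` fits into the same round, since no vertex besides `v` has its color yet:
      -- with such a `w` also `τ w` would have it, and one of the two is adjacent to `v`.
      ... | no τv≢v = τ v , subst (λ r → Legal r (play i c v) (τ v)) (sym same) legal
                    , color-pair c v τv≢v (cong just (sym same)) I
        where
        cτv = trans (I v) cv
        legal : Legal (round i c) (play i c v) (τ v)
        legal = trans (lookup∘update′ τv≢v c _) cτv , λ w cw a → case lookup-update c v cw of λ where
          (inj₁ (refl , _)) → τ-nonadjacent v (adj-sym a)
          (inj₂ (w≢v , cw′)) →
            case τ-maximal τv≢v w≢v (λ { refl → case trans (sym cτv) cw′ of λ () }) of λ where
              (inj₁ vw)  → ok w cw′ vw
              (inj₂ vτw) → ok (τ w) (trans (I w) cw′) vτw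
        same = legal-round (step pos leg) legal

    -- In the final coloring `f b` and `τ (f b)` share a color, so a neighbor of either one differs
    -- in color from `f b`.
    pairing-lower : Even n → ∀ {r} (f : Fin r → Fin n) →
      (∀ {a b} → a Fin.< b → Adj (f a) (f b) ⊎ Adj (f a) (τ (f b))) →
      r ≤ value Alice n 1 (replicate n nothing)
    pairing-lower even f adj = play-reply Bob Invariant reply
      (λ pos I → let open Final (final pos) in
        clique-bound f λ {a} {b} a<b e → case adj a<b of λ where
          (inj₁ ab)  → proper ab e
          (inj₂ aτb) → proper aτb (trans e (sym (final-cong pos (I (f b))))))
      even initial
      λ v → trans (lookup-replicate (τ v) nothing) (sym (lookup-replicate v nothing))

  -- Colors of a crown in a finished coloring.

  module _ {i} (F : Final i) where
    open Final F

    module _ {X Y : Fin n → Set}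
      (closed : ∀ {u w} → X u ⊎ Y u → color w ≡ color u → X w ⊎ Y w)
      (X-independent : ∀ {u w} → X u → X w → ¬ Adj u w)
      (Y-independent : ∀ {u w} → Y u → Y w → ¬ Adj u w)
      {x₀} (x₀∈X : X x₀) (misses : ∀ {y} → Y y → color y ≢ color x₀)
      (least : ∀ {u} → X u ⊎ Y u → color x₀ ≤ color u) where

      -- Think of `X` and `Y` as the sides of a crown. A vertex of `X` with a greater color than
      -- `x₀` would have a neighbor colored like `x₀`. That neighbor lies in `X` or `Y`, but `X` is
      -- independent and `Y` misses this color.
      monochromatic : ∀ {u} → X u → color u ≡ color x₀
      monochromatic {u} u∈X with m≤n⇒m<n∨m≡n (least (inj₁ u∈X))
      ... | inj₂ e = sym e
      ... | inj₁ lt =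
        let w , a , e = greedy lt in case closed (inj₁ x₀∈X) e of λ where
          (inj₁ w∈X) → contradiction a (X-independent u∈X w∈X)
          (inj₂ w∈Y) → contradiction e (misses w∈Y)

      -- The color of `x₀` fills `X` and misses `Y`, so a second color on `Y` would require an edge
      -- inside `Y`.
      opposite-not-less : ∀ {u w} → Y u → Y w → ¬ color u < color w
      opposite-not-less u∈Y w∈Y lt =
        let z , a , e = greedy lt in case closed (inj₂ u∈Y) e of λ where
          (inj₁ z∈X) → misses u∈Y (trans (sym e) (monochromatic z∈X))
          (inj₂ z∈Y) → Y-independent w∈Y z∈Y a

      opposite-monochromatic : ∀ {u w} → Y u → Y w → color u ≡ color w
      opposite-monochromatic u∈Y w∈Y =
        ≤-antisym (≮⇒≥ (opposite-not-less w∈Y u∈Y)) (≮⇒≥ (opposite-not-less u∈Y w∈Y))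

    module _ {m} (vtx : Bool → Fin m → Fin n)
      (cross : ∀ {s i j} → i ≢ j → Adj (vtx s i) (vtx (not s) j))
      (local : ∀ {s i t j w} → Adj (vtx s i) w → ¬ Adj w (vtx t j) → ∃ λ k → k ≢ i × w ≡ vtx (not s) k) where

      private
        hue : Bool → Fin m → ℕ
        hue s i = color (vtx s i)

        -- The hypothesis `local` applies because the neighbor shares its color with a vertex of the
        -- crown and so is not adjacent to it.
        greedy-neighbour : ∀ {s i t j} → hue t j < hue s i → ∃ λ k → k ≢ i × hue (not s) k ≡ hue t j
        greedy-neighbour lt =
          let w , a , e = greedy lt
              k , k≢i , w≡ = local a (λ a′ → proper a′ e)
          in k , k≢i , trans (cong color (sym w≡)) e

        hue-cross : ∀ {s i k} → hue (not s) k ≡ hue s i → k ≡ i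
        hue-cross {s} {i} {k} e with k Fin.≟ i
        ... | yes k≡i = k≡i
        ... | no  k≢i = contradiction (sym e) (proper (cross (k≢i ∘ sym)))

        Unpaired : Fin m → Set
        Unpaired i = hue false i ≢ hue true i

        -- Otherwise `vtx s j` has a neighbor of the smaller color on the opposite side. By
        -- `hue-cross` only the partner of `vtx s i` can have that color, and it does not, as `i` is
        -- unpaired.
        unpaired-not-less : ∀ s {i j} → Unpaired i → ¬ hue s i < hue s j
        unpaired-not-less s {i} ui lt with greedy-neighbour {s} lt
        ... | k , _ , e with hue-cross {s} e
        unpaired-not-less false ui lt | _ , _ , e | refl = ui (sym e)
        unpaired-not-less true  ui lt | _ , _ , e | refl = ui e

        unpaired-hue : ∀ s {i j} → Unpaired i → Unpaired j → hue s i ≡ hue s j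
        unpaired-hue s ui uj = ≤-antisym (≮⇒≥ (unpaired-not-less s uj)) (≮⇒≥ (unpaired-not-less s ui))

        -- The end of pair `i` with the greater color has a neighbor with the smaller color, in
        -- another pair `k`. If both ends of `k` had this color, `hue-cross` would give `k ≡ i`.
        second-unpaired : ∀ {i} → Unpaired i → ∃ λ j → j ≢ i × Unpaired j
        second-unpaired {i} ui with <-cmp (hue false i) (hue true i)
        ... | tri≈ _ e _ = contradiction e ui
        ... | tri< lt _ _ = let k , k≢i , e = greedy-neighbour {true} lt in
          k , k≢i , λ e′ → k≢i (hue-cross {false} (trans (sym e′) e))
        ... | tri> _ _ gt = let k , k≢i , e = greedy-neighbour {false} gt in
          k , k≢i , λ e′ → k≢i (hue-cross {true} (trans e′ e))

      -- A pair of equal colors contributes one color, and all unpaired vertices of one side share a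
      -- color. If unpaired indices exist, there are two of them, `i` and `j`: one can stand for
      -- side `false` and the other for side `true`. So a crown costs at most one color per pair,
      -- however it is played.
      crown-cover : ∃ λ (f : Fin m → Fin n) → ∀ s i → ∃ λ k → color (f k) ≡ color (vtx s i)
      crown-cover with any? (λ i → ¬? (hue false i ≟ hue true i))
      ... | no none = vtx false , λ where
        false i → i , refl
        true  i → i , decidable-stable (hue false i ≟ hue true i) (λ u → none (i , u))
      ... | yes (i , ui) with second-unpaired ui
      ...   | j , j≢i , uj = (λ k → vtx (does (k Fin.≟ j)) k) , cover
        where
        cover : ∀ s k → ∃ λ l → hue (does (l Fin.≟ j)) l ≡ hue s k
        cover s k with hue false k ≟ hue true k
        cover s k | yes e with does (k Fin.≟ j) in eq
        cover false k | yes e | false = k , cong (λ t → hue t k) eq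
        cover false k | yes e | true  = k , trans (cong (λ t → hue t k) eq) (sym e)
        cover true  k | yes e | false = k , trans (cong (λ t → hue t k) eq) e
        cover true  k | yes e | true  = k , cong (λ t → hue t k) eq
        cover false k | no uk = i , trans (cong (λ t → hue t i) (dec-false (i Fin.≟ j) (j≢i ∘ sym)))
                                      (unpaired-hue false ui uk)
        cover true  k | no uk = j , trans (cong (λ t → hue t j) (dec-true (j Fin.≟ j) refl))
                                      (unpaired-hue true uj uk)

-- The join of an apex and two crowns.

module Crowns (m₀ m₁ : ℕ) where

  -- Crowns are indexed by `Bool`. The summand 2 provides a second pair in each of them, as
  -- `other-index` requires.
  size : Bool → ℕ
  size g = 2 ℕ.+ (if g then m₁ else m₀)

  K : ℕ
  K = size false ℕ.+ size true

  crown : Fin K → Bool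
  crown x = [ const false , const true ]′ (splitAt (size false) x)

  emb : ∀ g → Fin (size g) → Fin K
  emb false i = i ↑ˡ size true
  emb true  i = size false ↑ʳ i

  crown-emb : ∀ g i → crown (emb g i) ≡ g
  crown-emb false i rewrite splitAt-↑ˡ (size false) i (size true)  = refl
  crown-emb true  i rewrite splitAt-↑ʳ (size false) (size true) i = refl

  emb-surjective : ∀ x → ∃ λ i → emb (crown x) i ≡ x
  emb-surjective x with splitAt (size false) x in eq
  ... | inj₁ i = i , splitAt⁻¹-↑ˡ eq
  ... | inj₂ i = i , splitAt⁻¹-↑ʳ eq

  emb-onto : ∀ {g x} → crown x ≡ g → ∃ λ i → emb g i ≡ x
  emb-onto {x = x} refl = emb-surjective x

  emb-injective : ∀ g {i j} → emb g i ≡ emb g j → i ≡ j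
  emb-injective false = Fin.↑ˡ-injective (size true) _ _
  emb-injective true  = Fin.↑ʳ-injective (size false) _ _

  other-index : ∀ g (i : Fin (size g)) → ∃ λ j → j ≢ i
  other-index g zero    = suc zero , λ ()
  other-index g (suc i) = zero , λ ()

  other : ∀ x → ∃ λ y → y ≢ x × crown y ≡ crown x
  other x =
    let i , e = emb-surjective x
        j , j≢i = other-index (crown x) i
    in emb (crown x) j , (λ e′ → j≢i (emb-injective (crown x) (trans e′ (sym e)))) , crown-emb (crown x) j

  -- pt s x is the vertex on side s of the x-th pair; its non-neighbor on the
  -- other side of the same crown is pt (not s) x.
  data Label : Set where
    apex : Label
    pt   : Bool → Fin K → Label

  pt-injective : ∀ {s t x y} → pt s x ≡ pt t y → s ≡ t × x ≡ y
  pt-injective refl = refl , refl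

  infix 4 _~_
  _~_ : Label → Label → Set
  apex   ~ apex   = ⊥
  apex   ~ pt _ _ = ⊤
  pt _ _ ~ apex   = ⊤
  pt s x ~ pt t y = x ≢ y × (crown x ≡ crown y → s ≢ t)

  ~-sym : ∀ l m → l ~ m → m ~ l
  ~-sym apex     (pt _ _) _ = _
  ~-sym (pt _ _) apex     _ = _
  ~-sym (pt s x) (pt t y) (x≢y , s≢t) = x≢y ∘ sym , λ e → s≢t (sym e) ∘ sym

  ~-irrefl : ∀ l → ¬ (l ~ l)
  ~-irrefl (pt s x) (x≢x , _) = x≢x refl

  _~?_ : ∀ l m → Dec (l ~ m)
  apex   ~? apex   = no λ ()
  apex   ~? pt _ _ = yes _
  pt _ _ ~? apex   = yes _
  pt s x ~? pt t y = ¬? (x Fin.≟ y) ×-dec (crown x Bool.≟ crown y →-dec ¬? (s Bool.≟ t))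

  ≁⇒≡crown : ∀ {s t x y} → ¬ (pt s x ~ pt t y) → crown x ≡ crown y
  ≁⇒≡crown {x = x} {y} ≁ with crown x Bool.≟ crown y
  ... | yes e = e
  ... | no ≢c = ⊥-elim (≁ (≢c ∘ cong crown , λ e → ⊥-elim (≢c e)))

  -- The argument `f` selects the crowns in which Bob pairs the matched vertices; all other labels
  -- are fixed.
  swap : (Bool → Bool) → Label → Label
  swap f apex     = apex
  swap f (pt s x) = pt (f (crown x) xor s) x

  swap-involutive : ∀ f l → swap f (swap f l) ≡ l
  swap-involutive f apex     = refl
  swap-involutive f (pt s x) with f (crown x)
  ... | true  = cong (λ t → pt t x) (not-involutive s)
  ... | false = refl

  swap-≁ : ∀ f l → ¬ (l ~ swap f l)
  swap-≁ f (pt s x) (x≢x , _) = x≢x refl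

  -- Everything outside the crown of `l` is adjacent to `l`. Inside that crown `m` belongs to
  -- another pair, and one of `m` and `swap f m` lies on the side opposite to `l`.
  swap-maximal : ∀ f l m → swap f l ≢ l → m ≢ l → m ≢ swap f l → l ~ m ⊎ l ~ swap f m
  swap-maximal f apex     m        moved _ _ = contradiction refl moved
  swap-maximal f (pt s x) apex     _ _ _     = inj₁ _
  swap-maximal f (pt s x) (pt t y) moved m≢l m≢l′ with x Fin.≟ y
  ... | yes refl with f (crown x)
  ...   | false = contradiction refl moved
  ...   | true with t Bool.≟ s
  ...     | yes refl = contradiction refl m≢l
  ...     | no  t≢s  = contradiction (cong (λ u → pt u x) (¬-not t≢s)) m≢l′
  swap-maximal f (pt s x) (pt t y) moved m≢l m≢l′ | no x≢y with crown x Bool.≟ crown y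
  ... | no ≢c = inj₁ (x≢y , λ e → contradiction e ≢c)
  ... | yes e with s Bool.≟ t
  ...   | no  s≢t  = inj₁ (x≢y , λ _ → s≢t)
  ...   | yes refl rewrite sym e with f (crown x)
  ...     | false = contradiction refl moved
  ...     | true  = inj₂ (x≢y , λ _ → not-¬ refl)

  -- An isomorphism of `G` with the subgraph of the join induced by the labels in `Present`. The
  -- join and its vertex-deleted subgraphs all have this form, however their vertices are numbered.
  record Labelled {n} (G : Graph n) (Present : Label → Set) : Set where
    open Graph G using (Adj)
    field
      label     : Fin n → Label
      injective : ∀ {u v} → label u ≡ label v → u ≡ v
      adj⇒~     : ∀ {u v} → Adj u v → label u ~ label v
      ~⇒adj     : ∀ {u v} → label u ~ label v → Adj u v
      present   : ∀ v → Present (label v)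
      at        : ∀ l → Present l → Fin n
      label-at  : ∀ l p → label (at l p) ≡ l

    ~-adj : ∀ {u v l m} → label u ≡ l → label v ≡ m → l ~ m → Adj u v
    ~-adj refl refl = ~⇒adj

    at-adj : ∀ {l m} p q → l ~ m → Adj (at l p) (at m q)
    at-adj p q = ~-adj (label-at _ p) (label-at _ q)

    at-label : ∀ {v l} p → label v ≡ l → v ≡ at l p
    at-label p e = injective (trans e (sym (label-at _ p)))

    module _ (f : Bool → Bool) (swap-present : ∀ {l} → Present l → Present (swap f l)) where

      partner : Fin n → Fin n
      partner v = at (swap f (label v)) (swap-present (present v))

      label-partner : ∀ v → label (partner v) ≡ swap f (label v)
      label-partner v = label-at _ _

      partner-involutive : ∀ v → partner (partner v) ≡ v
      partner-involutive v = injective (trans (label-partner (partner v))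
        (trans (cong (swap f) (label-partner v)) (swap-involutive f (label v))))

      label-swap-lower : Even n → ∀ {r} (q : Fin r → Label) → (∀ i → Present (q i)) →
        (∀ {i j} → i Fin.< j → q i ~ q j ⊎ q i ~ swap f (q j)) →
        r ≤ Game.value G Alice n 1 (replicate n nothing)
      label-swap-lower even q pres adj = pairing-lower G partner partner-involutive
        (λ v a → swap-≁ f (label v) (subst (label v ~_) (label-partner v) (adj⇒~ a)))
        (λ {v} {w} moved w≢v w≢τv → case
          swap-maximal f (label v) (label w)
            (λ e → moved (injective (trans (label-partner v) e)))
            (w≢v ∘ injective)
            (λ e → w≢τv (injective (trans e (sym (label-partner v))))) of λ where
          (inj₁ a) → inj₁ (~⇒adj a)
          (inj₂ a) → inj₂ (~-adj refl (label-partner w) a))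
        even (λ i → at (q i) (pres i)) λ {i} {j} i<j → case adj i<j of λ where
          (inj₁ a) → inj₁ (at-adj (pres i) (pres j) a)
          (inj₂ a) → inj₂ (~-adj (label-at _ _) (trans (label-partner _) (cong (swap f) (label-at _ _))) a)

    -- Color classes and crowns in labelled graphs.

    OnSide : Bool → Bool → Fin n → Set
    OnSide g s v = ∃ λ x → label v ≡ pt s x × crown x ≡ g

    side-independent : ∀ {g s u v} → OnSide g s u → OnSide g s v → ¬ Adj u v
    side-independent (x , eu , cx) (y , ev , cy) a with adj⇒~ a
    ... | l rewrite eu | ev = proj₂ l (trans cx (sym cy)) refl

    module _ {i} (F : Final G i) where
      open Final F

      -- Vertices of equal color are not adjacent, and all non-neighbors of a crown vertex lie in
      -- its crown.
      crown-closed : ∀ {g s u w} → OnSide g s u ⊎ OnSide g (not s) u → color w ≡ color u →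
                     OnSide g s w ⊎ OnSide g (not s) w
      crown-closed {g} {s} {u} {w} on e = [ same , same ]′ on
        where
        same : ∀ {t} → OnSide g t u → OnSide g s w ⊎ OnSide g (not s) w
        same (x , eu , cx) with label w in ew
        ... | apex = contradiction e (proper (~-adj ew eu _))
        ... | pt t′ y with t′ Bool.≟ s
        ...   | yes refl = inj₁ (y , refl , trans (≁⇒≡crown ≁) cx)
          where
          ≁ : ¬ (pt s y ~ pt _ x)
          ≁ a = proper (~-adj ew eu a) e
        ...   | no t′≢s = inj₂ (y , cong (λ t → pt t y) (¬-not t′≢s) , trans (≁⇒≡crown ≁) cx)
          where
          ≁ : ¬ (pt t′ y ~ pt _ x)
          ≁ a = proper (~-adj ew eu a) e

      module _ {g} (complete : ∀ s {x} → crown x ≡ g → Present (pt s x)) where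

        vtx : Bool → Fin (size g) → Fin n
        vtx s i = at (pt s (emb g i)) (complete s (crown-emb g i))

        vtx-onto : ∀ {v s x} → label v ≡ pt s x → crown x ≡ g → ∃ λ i → v ≡ vtx s i
        vtx-onto {x = x} e c with emb-onto {x = x} c
        ... | i , refl = i , at-label _ e

        complete-crown-cover : ∃ λ (f : Fin (size g) → Fin n) →
          ∀ {v s x} → label v ≡ pt s x → crown x ≡ g → ∃ λ k → color (f k) ≡ color v
        complete-crown-cover =
          let f , cover = crown-cover G F vtx
                (λ {s} i≢j → at-adj _ _ (i≢j ∘ emb-injective g , λ _ → not-¬ refl)) local
          in f , λ {v} {s} {x} e c →
               let i , v≡ = vtx-onto {v} {s} {x} e c
                   k , e′ = cover s i
               in k , trans e′ (cong color (sym v≡))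
          where
          -- Having a non-neighbor in crown `g` puts `w` into `g`; being adjacent to `vtx s i` puts
          -- it on the other side and into another pair.
          local : ∀ {s i t j w} → Adj (vtx s i) w → ¬ Adj w (vtx t j) →
                  ∃ λ k → k ≢ i × w ≡ vtx (not s) k
          local {s} {i} {t} {j} {w} a ¬a with label w in ew
          ... | apex = ⊥-elim (¬a (~-adj ew (label-at _ _) _))
          ... | pt s′ y with emb-onto {x = y} (trans (≁⇒≡crown {s′} {t} {y} {emb g j} λ a′ →
                  ¬a (~-adj ew (label-at _ _) a′)) (crown-emb g j))
          ...   | k , refl with subst (_~ label w) (label-at _ _) (adj⇒~ a)
          ...     | a″ rewrite ew = k , (λ { refl → proj₁ a″ refl })
            , at-label _ (trans ew (cong (λ u → pt u (emb g k))
                (¬-not (proj₂ a″ (trans (crown-emb g i) (sym (crown-emb g k))) ∘ sym))))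

  -- The definition of `χ` splits on the number of vertices; a given vertex excludes the empty
  -- graph.
  χ-value : ∀ {n} (G : Graph n) → Fin n → χ G ≡ Game.value G Alice n 1 (replicate n nothing)
  χ-value {suc n} G _ = refl

  -- Deletion of the apex.

  module _ {n} {G : Graph n} where
    open Graph G using (Adj)
    open Game G using (value)

    module _ (L : Labelled G (_≢ apex)) (even : Even n) where
      open Labelled L

      -- Bob answers with the matched vertex throughout. One vertex from each pair then gives `K`
      -- different colors.
      apexless-lower : K ≤ value Alice n 1 (replicate n nothing)
      apexless-lower = label-swap-lower (const true)
        (λ { {apex} p _ → p refl ; {pt _ _} _ () }) even (pt false) (λ _ ())
        λ i<j → inj₂ (Fin.<⇒≢ i<j , λ _ ())

      apexless-upper : value Alice n 1 (replicate n nothing) ≤ K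
      apexless-upper = play-any G Alice (λ _ → ⊤) _ (λ pos _ → end (final G pos)) Alice (initial G) _
        where
        end : ∀ {i} → Final G i → i ≤ K
        end F = cover-bound ([ proj₁ (cover false) , proj₁ (cover true) ]′ ∘ splitAt (size false))
                  (λ v → slot v (label v) refl (present v)) (at (pt false zero) λ ())
          where
          open Final F
          cover = λ g → complete-crown-cover F {g} λ _ _ ()
          slot : ∀ v l → label v ≡ l → l ≢ apex → ∃ λ k →
            color ([ proj₁ (cover false) , proj₁ (cover true) ]′ (splitAt (size false) k)) ≡ color v
          slot v apex     _ l≢ = contradiction refl l≢
          slot v (pt s x) e _ with crown x in cx
          ... | false = let k , e′ = proj₂ (cover false) e cx in
            k ↑ˡ size true , trans (cong (color ∘ [ _ , _ ]′) (splitAt-↑ˡ (size false) k (size true))) e′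
          ... | true = let k , e′ = proj₂ (cover true) e cx in
            size false ↑ʳ k , trans (cong (color ∘ [ _ , _ ]′) (splitAt-↑ʳ (size false) (size true) k)) e′

      χ-apexless : χ G ≡ K
      χ-apexless = trans (χ-value G (at (pt false zero) λ ())) (≤-antisym apexless-upper apexless-lower)

    -- Deletion of a crown vertex.

    module _ {s p} (L : Labelled G (_≢ pt s p)) (even : Even n) where
      open Labelled L

      private
        g = crown p
        z = proj₁ (other p)
        z≢p = proj₁ (proj₂ (other p))
        crown-z = proj₂ (proj₂ (other p))

        other-crown : ∀ {t x} → crown x ≡ not g → pt t x ≢ pt s p
        other-crown cx e = not-¬ refl (trans (cong crown (sym (proj₂ (pt-injective e)))) cx)

        not-s : ∀ {x} → pt (not s) x ≢ pt s p
        not-s e = not-¬ refl (sym (proj₁ (pt-injective e)))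

      -- The selector `_xor g` is true only at the undamaged crown, so the swap fixes the missing
      -- label. The vertices counted are the apex, both ends of an edge of the damaged crown, and
      -- one vertex from each pair of the other crown.
      punctured-lower : 3 ℕ.+ size (not g) ≤ value Alice n 1 (replicate n nothing)
      punctured-lower = label-swap-lower (_xor g)
        (λ {l} l≢ e → l≢ (trans (sym (swap-involutive (_xor g) l)) (trans (cong (swap (_xor g)) e)
           (cong (λ t → pt (t xor s) p) (xor-same g)))))
        even q q-present adjacent
        where
        q : Fin (3 ℕ.+ size (not g)) → Label
        q zero                = apex
        q (suc zero)          = pt s z
        q (suc (suc zero))    = pt (not s) p
        q (suc (suc (suc i))) = pt false (emb (not g) i)
        q-present : ∀ i → q i ≢ pt s p
        q-present zero                = λ ()
        q-present (suc zero)          = z≢p ∘ proj₂ ∘ pt-injective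
        q-present (suc (suc zero))    = not-s
        q-present (suc (suc (suc i))) = other-crown (crown-emb (not g) i)
        across : ∀ {t u x i} → crown x ≡ g → pt t x ~ pt u (emb (not g) i)
        across {i = i} cx = (λ e → ≢c (cong crown e)) , λ e → contradiction e ≢c
          where
          ≢c = λ e → not-¬ {g} refl (trans (sym cx) (trans e (crown-emb (not g) i)))
        swapped : ∀ i → swap (_xor g) (pt false (emb (not g) i)) ≡ pt true (emb (not g) i)
        swapped i = cong (λ t → pt (t xor false) (emb (not g) i))
          (trans (cong (_xor g) (crown-emb (not g) i)) (not-xor-same g))
          where
          not-xor-same : ∀ t → not t xor t ≡ true
          not-xor-same false = refl
          not-xor-same true  = refl
        adjacent : ∀ {i j} → i Fin.< j → q i ~ q j ⊎ q i ~ swap (_xor g) (q j)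
        adjacent {zero} {suc zero} _ = inj₁ _
        adjacent {zero} {suc (suc zero)} _ = inj₁ _
        adjacent {zero} {suc (suc (suc _))} _ = inj₁ _
        adjacent {suc zero} {suc (suc zero)} _ = inj₁ (z≢p , λ _ → not-¬ refl)
        adjacent {suc zero} {suc (suc (suc _))} _ = inj₁ (across crown-z)
        adjacent {suc (suc zero)} {suc (suc (suc _))} _ = inj₁ (across refl)
        adjacent {suc (suc (suc i))} {suc (suc (suc j))} (s≤s (s≤s (s≤s i<j))) =
          inj₂ (subst (pt false (emb (not g) i) ~_) (sym (swapped j))
            (Fin.<⇒≢ i<j ∘ emb-injective (not g) , λ _ ()))
        adjacent {suc zero} {suc zero} (s≤s ())
        adjacent {suc (suc zero)} {suc zero} (s≤s ())
        adjacent {suc (suc zero)} {suc (suc zero)} (s≤s (s≤s ()))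
        adjacent {suc (suc (suc _))} {suc zero} (s≤s ())
        adjacent {suc (suc (suc _))} {suc (suc zero)} (s≤s (s≤s ()))

      -- Once the partner of the missing vertex has color 1, its whole side does.
      punctured-final : ∀ {i} (F : Final G i) → Final.color F (at (pt (not s) p) not-s) ≡ 1 →
                        i ≤ 3 ℕ.+ size (not g)
      punctured-final F e₁ = cover-bound rep (λ v → slot v (label v) refl (present v)) (at apex λ ())
        where
        open Final F
        b = at (pt (not s) p) not-s
        a = at (pt s z) (z≢p ∘ proj₂ ∘ pt-injective)
        crown-cover′ = complete-crown-cover F {not g} λ _ → other-crown
        rep : Fin (3 ℕ.+ size (not g)) → Fin n
        rep zero                = at apex λ ()
        rep (suc zero)          = a
        rep (suc (suc zero))    = b
        rep (suc (suc (suc k))) = proj₁ crown-cover′ k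
        X Y : Fin n → Set
        X = OnSide g (not s)
        Y = OnSide g s
        closed : ∀ {u w} → X u ⊎ Y u → color w ≡ color u → X w ⊎ Y w
        -- The cases are exchanged because `crown-closed` is used for side `s`, which avoids
        -- `not (not s)`.
        closed on e = [ inj₂ , inj₁ ]′ (crown-closed F ([ inj₂ , inj₁ ]′ on) e)
        b∈X : X b
        b∈X = p , label-at _ _ , refl
        -- With its partner missing, `b` is adjacent to the whole opposite side.
        misses : ∀ {y} → Y y → color y ≢ color b
        misses {y} (x , ey , cx) = proper (~-adj ey (label-at _ _)
          ((λ x≡p → present y (trans ey (cong (pt s) x≡p))) , λ _ → not-¬ refl))
        least : ∀ {u} → X u ⊎ Y u → color b ≤ color u
        least {u} _ rewrite e₁ = positive u
        slot : ∀ v l → label v ≡ l → l ≢ pt s p → ∃ λ k → color (rep k) ≡ color v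
        slot v apex e _ = zero , cong color (sym (at-label _ e))
        slot v (pt t x) e _ with crown x Bool.≟ g
        ... | no ≢g = let k , e′ = proj₂ crown-cover′ e (¬-not ≢g) in suc (suc (suc k)) , e′
        ... | yes cx with t Bool.≟ s
        ...   | yes refl = suc zero , opposite-monochromatic G F closed side-independent side-independent
                  b∈X misses least (z , label-at _ _ , crown-z) (x , e , cx)
        ...   | no t≢s = suc (suc zero) , sym (monochromatic G F closed side-independent side-independent
                  b∈X misses least (x , trans e (cong (λ u → pt u x) (¬-not t≢s)) , cx))

      -- Alice has to choose only the opening move; every continuation then meets the bound.
      punctured-upper : value Alice n 1 (replicate n nothing) ≤ 3 ℕ.+ size (not g)
      punctured-upper = go even (initial G)
        where
        b = at (pt (not s) p) not-s
        go : ∀ {k} → Even k → Position G k 1 (replicate n nothing) →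
             value Alice k 1 (replicate n nothing) ≤ 3 ℕ.+ size (not g)
        -- Matching on parity exposes the successor that `value-own` needs; with no vertices the
        -- value would be 1.
        go even-zero _ = s≤s z≤n
        go (even-2+ e) pos = value-own G Alice pos (opening-move G b)
          (play-any G Alice (λ c → lookup c b ≡ just 1)
            (λ {i} {c} v cb cv → colored-after c v cv cb)
            (λ pos′ cb → punctured-final (final G pos′) (final-color G pos′ cb))
            Bob (step G pos (opening-move G b))
            (trans (lookup∘update b (replicate n nothing) _) (cong just (opening-round G b))))

      χ-punctured : χ G ≡ 3 ℕ.+ size (not g)
      χ-punctured = trans (χ-value G (at apex λ ())) (≤-antisym punctured-upper punctured-lower)

  -- The whole join.

  module _ {n} {G : Graph n} (L : Labelled G (const ⊤)) where
    open Graph G using (Adj)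
    open Game G using (Legal; round; value)
    open Labelled L

    private
      start : Coloring n
      start = replicate n nothing

      top : Fin n
      top = at apex _

      corner : Bool → Bool → Fin n
      corner g s = at (pt s (emb g zero)) _

    -- The clique consists of the apex and the ends of one edge in each crown.
    full-lower : 5 ≤ value Alice n 1 start
    full-lower = clique-lower G (λ i → at (q i) _) (λ i<j → at-adj _ _ (adjacent i<j))
      where
      q : Fin 5 → Label
      q zero                         = apex
      q (suc zero)                   = pt false (emb false zero)
      q (suc (suc zero))             = pt true (emb false (suc zero))
      q (suc (suc (suc zero)))       = pt false (emb true zero)
      q (suc (suc (suc (suc zero)))) = pt true (emb true (suc zero))
      inside : ∀ g → pt false (emb g zero) ~ pt true (emb g (suc zero))
      inside g = (λ e → case emb-injective g e of λ ()) , λ _ ()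
      across : ∀ {s t} i j → pt s (emb false i) ~ pt t (emb true j)
      across i j = (λ e → ≢c (cong crown e)) , λ e → contradiction e ≢c
        where
        ≢c : crown (emb false i) ≢ crown (emb true j)
        ≢c e = case trans (sym (crown-emb false i)) (trans e (crown-emb true j)) of λ ()
      adjacent : ∀ {i j} → i Fin.< j → q i ~ q j
      adjacent {zero} {suc zero} _ = _
      adjacent {zero} {suc (suc zero)} _ = _
      adjacent {zero} {suc (suc (suc zero))} _ = _
      adjacent {zero} {suc (suc (suc (suc zero)))} _ = _
      adjacent {suc zero} {suc (suc zero)} _ = inside false
      adjacent {suc zero} {suc (suc (suc zero))} _ = across zero zero
      adjacent {suc zero} {suc (suc (suc (suc zero)))} _ = across zero (suc zero)
      adjacent {suc (suc zero)} {suc (suc (suc zero))} _ = across (suc zero) zero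
      adjacent {suc (suc zero)} {suc (suc (suc (suc zero)))} _ = across (suc zero) (suc zero)
      adjacent {suc (suc (suc zero))} {suc (suc (suc (suc zero)))} _ = inside true
      adjacent {suc zero} {suc zero} (s≤s ())
      adjacent {suc (suc zero)} {suc zero} (s≤s ())
      adjacent {suc (suc zero)} {suc (suc zero)} (s≤s (s≤s ()))
      adjacent {suc (suc (suc zero))} {suc zero} (s≤s ())
      adjacent {suc (suc (suc zero))} {suc (suc zero)} (s≤s (s≤s ()))
      adjacent {suc (suc (suc zero))} {suc (suc (suc zero))} (s≤s (s≤s (s≤s ())))
      adjacent {suc (suc (suc (suc zero)))} {suc zero} (s≤s ())
      adjacent {suc (suc (suc (suc zero)))} {suc (suc zero)} (s≤s (s≤s ()))
      adjacent {suc (suc (suc (suc zero)))} {suc (suc (suc zero))} (s≤s (s≤s (s≤s ())))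
      adjacent {suc (suc (suc (suc zero)))} {suc (suc (suc (suc zero)))} (s≤s (s≤s (s≤s (s≤s ()))))

    Untouched : Coloring n → Bool → Set
    Untouched c g = ∀ {s v} → OnSide g s v → lookup c v ≡ nothing

    -- The crown has been opened in favor of Alice. Every vertex of the opposite side is adjacent to
    -- `u` or `w`, so `hue` stays on one side; as the earliest color of the crown it ends up on that
    -- whole side.
    record Committed (c : Coloring n) (g : Bool) : Set where
      field
        {hue}    : ℕ
        {side}   : Bool
        {u w}    : Fin n
        on-u     : OnSide g side u
        on-w     : OnSide g side w
        u≢w      : u ≢ w
        color-u  : lookup c u ≡ just hue
        color-w  : lookup c w ≡ just hue
        earliest : ∀ {s v t} → OnSide g s v → lookup c v ≡ just t → hue ≤ t

    -- The invariant that Alice restores with each answer.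
    Prepared : Coloring n → Set
    Prepared c = (∃ λ t → lookup c top ≡ just t) × (∀ g → Untouched c g ⊎ Committed c g)

    committed-play : ∀ {k i c v g} → Position G (suc k) i c → Move G i c v →
                     Committed c g → Committed (play G i c v) g
    committed-play {c = c} {v} pos (cv , _) com = record
      { on-u = on-u ; on-w = on-w ; u≢w = u≢w
      ; color-u  = colored-after c v cv color-u
      ; color-w  = colored-after c v cv color-w
      ; earliest = λ on e → case lookup-update c v e of λ where
          (inj₁ (_ , refl)) → ≤-trans (Position.bounded pos color-u) (round≥ G pos)
          (inj₂ (_ , e′))   → earliest on e′
      }
      where open Committed com

    untouched-play : ∀ {i c v g} → (∀ {s} → ¬ OnSide g s v) → Untouched c g → Untouched (play G i c v) g
    untouched-play {c = c} off unt on = trans (lookup∘update′ (λ { refl → off on }) c _) (unt on)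

    -- The hypothesis `touched` only excludes that the move opens a crown.
    prepared-play : ∀ {k i c v} → Position G (suc k) i c → Move G i c v →
      (∀ {g s} → OnSide g s v → Committed c g) → Prepared c → Prepared (play G i c v)
    prepared-play {i = i} {c} {v} pos leg touched ((t , e) , status) =
      (t , colored-after c v (proj₁ leg) e) , status′
      where
      status′ : ∀ g → Untouched (play G i c v) g ⊎ Committed (play G i c v) g
      status′ g with status g
      ... | inj₂ com = inj₂ (committed-play pos leg com)
      ... | inj₁ unt with label v in ev
      ...   | apex = inj₁ (untouched-play {c = c} (λ { (_ , e′ , _) → case trans (sym ev) e′ of λ () }) unt)
      ...   | pt s x with crown x Bool.≟ g
      ...     | yes cx = inj₂ (committed-play pos leg (touched (x , refl , cx)))
      ...     | no ≢g  = inj₁ (untouched-play {c = c} (λ { (y , e′ , cy) →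
                  ≢g (trans (cong crown (proj₂ (pt-injective (trans (sym ev) e′)))) cy) }) unt)

    -- If Bob opens a crown, Alice answers on the same side. Otherwise he plays in a committed
    -- crown, and `free-reply` finds a move that opens no crown: the vertices of untouched crowns
    -- come in uncolored matched pairs and are adjacent to `v`.
    prepared-reply : ∀ {k i c v} → Position G (suc k) i c → Prepared c → Even (suc k) → Move G i c v →
      ∃ λ u → Move G (round i c) (play G i c v) u × Prepared (play G (round i c) (play G i c v) u)
    prepared-reply {zero} _ _ ()
    prepared-reply {suc k} {i} {c} {v} pos prep@((_ , ct) , status) even leg@(cv , ok) = reply (label v) refl
      where
      j  = round i c
      c₁ = play G i c v
      pos₁ = step G pos leg
      Goal = ∃ λ u → Move G j c₁ u × Prepared (play G j c₁ u)

      Free : Label → Set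
      Free apex     = ⊤
      Free (pt _ x) = [ const ⊥ , const ⊤ ]′ (status (crown x))

      free? : ∀ l → Dec (Free l)
      free? apex     = yes _
      free? (pt _ x) with status (crown x)
      ... | inj₁ _ = no λ ()
      ... | inj₂ _ = yes _

      free⇒committed : ∀ {t x} → Free (pt t x) → Committed c (crown x)
      free⇒committed {x = x} free with status (crown x)
      ... | inj₂ com = com

      in-committed : ∀ {s x} → label v ≡ pt s x → Committed c (crown x) → Goal
      in-committed {s} {x} ev com =
        let u , free , legal = free-reply G pos even leg (free? ∘ label) τ (partner-involutive (const true) _)
              λ w cw w≢v ¬free → away w (label w) refl ¬free
        in u , legal , prepared-play pos₁ legal
             (λ { {s = t} (y , e , refl) →
               committed-play pos leg (free⇒committed {t} {y} (subst Free e free)) })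
             (prepared-play pos leg (λ { (y , e , refl) →
               subst (Committed c) (cong crown (proj₂ (pt-injective (trans (sym ev) e)))) com }) prep)
        where
        τ = partner (const true) _
        away : ∀ w l → label w ≡ l → ¬ Free l → Adj w v × τ w ≢ w × τ w ≢ v × lookup c (τ w) ≡ nothing
        away w apex     _  ¬free = contradiction _ ¬free
        away w (pt t y) ew ¬free with status (crown y)
        ... | inj₂ _   = contradiction _ ¬free
        ... | inj₁ unt =
          ~-adj ew ev (≢x ∘ cong crown , λ e → contradiction e ≢x)
          , (λ e → not-¬ refl (sym (proj₁ (pt-injective (trans (sym eτ) (trans (cong label e) ew))))))
          , (λ e → ≢x (cong crown (proj₂ (pt-injective (trans (sym eτ) (trans (cong label e) ev))))))
          , unt (y , eτ , refl)
          where
          eτ : label (τ w) ≡ pt (not t) y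
          eτ = trans (label-partner (const true) _ w) (cong (swap (const true)) ew)
          ≢x : crown y ≢ crown x
          ≢x e = case trans (sym color-u) (unt (subst (λ g → OnSide g _ _) (sym e) on-u)) of λ ()
            where open Committed com

      in-untouched : ∀ {s x} → label v ≡ pt s x → Untouched c (crown x) → Goal
      in-untouched {s} {x} ev unt =
        u , legal , (_ , colored-after c₁ u cu (colored-after c v cv ct)) , status′
        where
        g = crown x
        y = proj₁ (other x)
        y≢x = proj₁ (proj₂ (other x))
        crown-y = proj₂ (proj₂ (other x))
        u = at (pt s y) _
        on-v : OnSide g s v
        on-v = x , ev , refl
        on-u : OnSide g s u
        on-u = y , label-at _ _ , crown-y
        u≢v : u ≢ v
        u≢v e = y≢x (proj₂ (pt-injective (trans (sym (label-at _ _)) (trans (cong label e) ev))))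
        cu : lookup c₁ u ≡ nothing
        cu = trans (lookup∘update′ u≢v c _) (unt on-u)
        -- No vertex had color `j` before Bob's move: not being adjacent to `v`, it would lie in the
        -- crown of `v`, which was untouched.
        isolated : ∀ w l → label w ≡ l → lookup c w ≡ just j → ¬ Adj v w → ⊥
        isolated w apex     ew _  ¬a = ¬a (~-adj ev ew _)
        isolated w (pt t z) ew cw ¬a =
          case trans (sym cw) (unt (z , ew , sym (≁⇒≡crown {s} {t} (¬a ∘ ~-adj ev ew)))) of λ ()
        legal₁ : Legal j c₁ u
        legal₁ = cu , λ w cw a → case lookup-update c v cw of λ where
          (inj₁ (refl , _)) → side-independent on-u on-v a
          (inj₂ (_ , cw′))  → isolated w (label w) refl cw′ (ok w cw′)
        same = legal-round G pos₁ legal₁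
        legal : Move G j c₁ u
        legal = subst (λ r → Legal r c₁ u) (sym same) legal₁
        off : ∀ {g′ t w} → OnSide g s w → g′ ≢ g → ¬ OnSide g′ t w
        off (_ , e , c≡g) g′≢g (_ , e′ , c≡g′) =
          g′≢g (trans (sym c≡g′) (trans (cong crown (sym (proj₂ (pt-injective (trans (sym e) e′))))) c≡g))
        status′ : ∀ g′ → Untouched (play G j c₁ u) g′ ⊎ Committed (play G j c₁ u) g′
        status′ g′ with g′ Bool.≟ g
        ... | yes refl = inj₂ record
          { on-u = on-v ; on-w = on-u ; u≢w = u≢v ∘ sym
          ; color-u  = colored-after c₁ u cu (lookup∘update v c _)
          ; color-w  = trans (lookup∘update u c₁ _) (cong just same)
          ; earliest = λ on e → case lookup-update c₁ u e of λ where
              (inj₁ (_ , refl)) → round≥ G pos₁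
              (inj₂ (_ , e₁))   → case lookup-update c v e₁ of λ where
                (inj₁ (_ , refl)) → ≤-refl
                (inj₂ (_ , e₂))   → case trans (sym e₂) (unt on) of λ ()
          }
        ... | no g′≢g with status g′
        ...   | inj₂ com  = inj₂ (committed-play pos₁ legal (committed-play pos leg com))
        ...   | inj₁ unt′ = inj₁ (untouched-play {c = c₁} (off on-u g′≢g)
                                    (untouched-play {c = c} (off on-v g′≢g) unt′))

      reply : ∀ l → label v ≡ l → Goal
      reply apex     ev with trans (sym cv) (trans (cong (lookup c) (at-label _ ev)) ct)
      ... | ()
      reply (pt s x) ev = [ in-untouched ev , in-committed ev ]′ (status (crown x))

    module _ {i c} (pos : Position G 0 i c) where
      private F = final G pos
      open Final F

      committed-side : ∀ {g} → Committed c g → ∀ {s v w} → OnSide g s v → OnSide g s w → color v ≡ color w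
      committed-side {g} com = result
        where
        open Committed com renaming (side to σ; u to x₀; w to x₁)
        hue≡ : color x₀ ≡ hue
        hue≡ = final-color G pos color-u
        misses : ∀ {y} → OnSide g (not σ) y → color y ≢ color x₀
        misses {y} (z , ey , cz) e =
          let p , eₚ , cp = on-u
              q , e_q , cq = on-w
          in case z Fin.≟ p of λ where
            (no z≢p)   → proper (~-adj ey eₚ (z≢p , λ _ → not-¬ refl ∘ sym)) e
            -- The partner of `x₀` is adjacent to `x₁`, which has the same color as `x₀`.
            (yes refl) → proper (~-adj ey e_q ((λ { refl → u≢w (injective (trans eₚ (sym e_q))) })
                                              , λ _ → not-¬ refl ∘ sym))
                           (trans e (final-cong G pos (trans color-u (sym color-w))))
        colored-by : ∀ v → lookup c v ≡ just (color v)
        colored-by v =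
          let t , e = colored c (Position.count pos) v
          in trans e (cong just (sym (final-color G pos e)))
        least : ∀ {v} → OnSide g σ v ⊎ OnSide g (not σ) v → color x₀ ≤ color v
        least {v} on = subst (_≤ color v) (sym hue≡)
          ([ (λ o → earliest o (colored-by v)) , (λ o → earliest o (colored-by v)) ]′ on)
        mono = monochromatic G F (crown-closed F) side-independent side-independent on-u misses least
        result : ∀ {s v w} → OnSide g s v → OnSide g s w → color v ≡ color w
        result {s} with s Bool.≟ σ
        ... | yes refl = λ on on′ → trans (mono on) (sym (mono on′))
        ... | no  s≢σ rewrite ¬-not s≢σ =
          opposite-monochromatic G F (crown-closed F) side-independent side-independent on-u misses least

      prepared-final : Prepared c → i ≤ 5
      prepared-final (_ , status) = cover-bound rep (λ v → slot v (label v) refl) top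
        where
        rep : Fin 5 → Fin n
        rep zero                         = top
        rep (suc zero)                   = corner false false
        rep (suc (suc zero))             = corner false true
        rep (suc (suc (suc zero)))       = corner true false
        rep (suc (suc (suc (suc zero)))) = corner true true
        index : ∀ g s → ∃ λ k → rep k ≡ corner g s
        index false false = suc zero , refl
        index false true  = suc (suc zero) , refl
        index true  false = suc (suc (suc zero)) , refl
        index true  true  = suc (suc (suc (suc zero))) , refl
        slot : ∀ v l → label v ≡ l → ∃ λ k → color (rep k) ≡ color v
        slot v apex     e = zero , cong color (sym (at-label _ e))
        slot v (pt s x) e =
          let k , eₖ = index (crown x) s
              on-corner = emb (crown x) zero , label-at _ _ , crown-emb (crown x) zero
              _ , cv = colored c (Position.count pos) v
          in k , trans (cong color eₖ)
               ([ (λ unt → case trans (sym cv) (unt (x , e , refl)) of λ ())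
                , (λ com → committed-side com on-corner (x , e , refl)) ]′ (status (crown x)))

    -- Once Alice has taken the apex, Bob is to move with an even number of vertices left, as
    -- `play-reply` requires.
    full-upper : (∃ λ k → n ≡ suc k × Even k) → value Alice n 1 start ≤ 5
    full-upper (k , refl , even) = value-own G Alice pos legal
      (play-reply G Alice Prepared prepared-reply prepared-final even (step G pos legal) prepared)
      where
      pos = initial G
      legal = opening-move G top
      prepared : Prepared (play G 1 start top)
      prepared = (_ , lookup∘update top start _) , λ g → inj₁ (untouched-play {c = start}
        (λ { (_ , e , _) → case trans (sym (label-at apex _)) e of λ () })
        (λ {_} {v} _ → lookup-replicate v nothing))

    χ-full : (∃ λ k → n ≡ suc k × Even k) → χ G ≡ 5
    χ-full odd = trans (χ-value G top) (≤-antisym (full-upper odd) full-lower)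

  -- Realization of the join and deletion of vertices.

  N : ℕ
  N = K ℕ.+ K

  label : Fin (suc N) → Label
  label zero    = apex
  label (suc v) = [ pt false , pt true ]′ (splitAt K v)

  vertex : Label → Fin (suc N)
  vertex apex         = zero
  vertex (pt false x) = suc (x ↑ˡ K)
  vertex (pt true x)  = suc (K ↑ʳ x)

  label-vertex : ∀ l → label (vertex l) ≡ l
  label-vertex apex         = refl
  label-vertex (pt false x) = cong [ pt false , pt true ]′ (splitAt-↑ˡ K x K)
  label-vertex (pt true x)  = cong [ pt false , pt true ]′ (splitAt-↑ʳ K K x)

  vertex-label : ∀ v → vertex (label v) ≡ v
  vertex-label zero = refl
  vertex-label (suc v) with splitAt K v in e
  ... | inj₁ x = cong suc (splitAt⁻¹-↑ˡ e)
  ... | inj₂ x = cong suc (splitAt⁻¹-↑ʳ e)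

  label-injective : ∀ {u v} → label u ≡ label v → u ≡ v
  label-injective {u} {v} e = trans (sym (vertex-label u)) (trans (cong vertex e) (vertex-label v))

  graph : Graph (suc N)
  graph = record
    { Adj    = λ u v → label u ~ label v
    ; adj?   = λ u v → label u ~? label v
    ; sym    = λ {u} {v} → ~-sym (label u) (label v)
    ; irrefl = λ { {u} refl → ~-irrefl (label u) }
    }

  labelled : Labelled graph (const ⊤)
  labelled = record
    { label = label ; injective = label-injective ; adj⇒~ = λ a → a ; ~⇒adj = λ a → a
    ; present = _ ; at = λ l _ → vertex l ; label-at = λ l _ → label-vertex l }

  -- The number of vertices stays abstract: χ unfolds on a concrete one.
  module _ {m} {G : Graph (suc m)} (L : Labelled G (const ⊤)) (even : Even m) where
    open Labelled L using (injective; adj⇒~; ~⇒adj; at; label-at) renaming (label to labelᴳ)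

    -- The labels absorb the renumbering by `punchIn`, and by injectivity no remaining vertex
    -- carries the deleted label.
    labelled-delete : ∀ {x l} → labelᴳ x ≡ l → Labelled (G -ᵛ x) (_≢ l)
    labelled-delete {x} refl = record
      { label     = labelᴳ ∘ punchIn x
      ; injective = λ e → punchIn-injective x _ _ (injective e)
      ; adj⇒~     = adj⇒~
      ; ~⇒adj     = ~⇒adj
      ; present   = λ v e → punchInᵢ≢i x v (injective e)
      ; at        = λ l l≢ → punchOut (x≢at l≢)
      ; label-at  = λ l l≢ → trans (cong labelᴳ (punchIn-punchOut (x≢at l≢))) (label-at l _)
      }
      where
      x≢at : ∀ {l} → l ≢ labelᴳ x → x ≢ at l _
      x≢at {l} l≢ e = l≢ (trans (sym (label-at l _)) (cong labelᴳ (sym e)))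

    χ-delete-apex : χ (G -ᵛ at apex _) ≡ K
    χ-delete-apex = χ-apexless (labelled-delete (label-at apex _)) even

    χ-delete-pt : ∀ {x s p} → labelᴳ x ≡ pt s p → χ (G -ᵛ x) ≡ 3 ℕ.+ size (not (crown p))
    χ-delete-pt e = χ-punctured (labelled-delete e) even

    χ-delete : ∀ x → χ (G -ᵛ x) ≡ K ⊎ ∃ λ g → χ (G -ᵛ x) ≡ 3 ℕ.+ size g
    χ-delete x = by-label (labelᴳ x) refl
      where
      by-label : ∀ l → labelᴳ x ≡ l → χ (G -ᵛ x) ≡ K ⊎ ∃ λ g → χ (G -ᵛ x) ≡ 3 ℕ.+ size g
      by-label apex     e = inj₁ (χ-apexless (labelled-delete e) even)
      by-label (pt s p) e = inj₂ (not (crown p) , χ-delete-pt e)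

-- The set of differences and the choice of sizes.

crowns-of-size-3-and-3+ : ∀ j {m} {G : Graph (suc m)} → Crowns.Labelled 1 (suc j) G (const ⊤) → Even m →
  ∀ {z} → z ≡ -[1+ j ] →
  UpperGameVertexCritical G × (λ (d : ℤ) → ∃[ x ] d ≡ + χ G - + χ (G -ᵛ x)) ≐ (｛ -1ℤ ｝ ∪ ｛ z ｝)
crowns-of-size-3-and-3+ j {m} {G} L even {z} z≡ =
  critical , (λ { (x , refl) → forth x }) , λ { (inj₁ refl) → near , sym (difference near-χ)
                                             ; (inj₂ refl) → far , trans z≡ (sym (difference far-χ)) }
  where
  open Crowns 1 (suc j)
  χ-G : χ G ≡ 5
  χ-G = χ-full L (m , refl , even)
  -- The sizes are 3 and `3 + j`, so `K` is `6 + j`, and a damaged crown gives 3 plus the size of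
  -- the other one.
  χ-cases : ∀ x → χ (G -ᵛ x) ≡ 6 ⊎ χ (G -ᵛ x) ≡ 6 ℕ.+ j
  χ-cases x with χ-delete L even x
  ... | inj₁ e           = inj₂ e
  ... | inj₂ (false , e) = inj₁ e
  ... | inj₂ (true  , e) = inj₂ e
  critical : UpperGameVertexCritical G
  critical x = subst (_< χ (G -ᵛ x)) (sym χ-G)
    ([ (λ e → subst (5 <_) (sym e) ≤-refl) , (λ e → subst (5 <_) (sym e) (m≤m+n 6 j)) ]′ (χ-cases x))
  difference : ∀ {x c} → χ (G -ᵛ x) ≡ c → + χ G - + χ (G -ᵛ x) ≡ + 5 - + c
  difference = cong₂ (λ p q → + p - + q) χ-G
  forth : ∀ x → (｛ -1ℤ ｝ ∪ ｛ z ｝) (+ χ G - + χ (G -ᵛ x))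
  forth x = [ (λ e → inj₁ (sym (difference {x} e)))
            , (λ e → inj₂ (trans z≡ (sym (difference {x} e)))) ]′ (χ-cases x)
  -- Damaging the large crown leaves the crown of size 3 intact, hence 6 rounds; deleting the apex
  -- realizes the other value.
  p = emb true zero
  near far : Fin (suc m)
  near = Labelled.at L (pt false p) _
  far  = Labelled.at L apex _
  near-χ : χ (G -ᵛ near) ≡ 6
  near-χ = trans (χ-delete-pt L even (Labelled.label-at L _ _))
    (cong (λ g → 3 ℕ.+ size (not g)) (crown-emb true zero))
  far-χ : χ (G -ᵛ far) ≡ 6 ℕ.+ j
  far-χ = χ-delete-apex L even

proposition19 : ∀ (n : ℕ) → 2 ≤ n →
    ∃[ m ] Σ[ G ∈ Graph m ]
    UpperGameVertexCritical G ×
    (λ (d : ℤ) → ∃[ x ] d ≡ + χ G - + χ (G -ᵛ x))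
    ≐ (｛ -1ℤ ｝ ∪ ｛ - (+ 2 * + n) + + 3 ｝)
proposition19 (suc zero) (s≤s ())
proposition19 (suc (suc k)) _ = realize labelled (even-double K)
  where
  -- With `n = k + 2` the large crown has size `2n - 1 = 3 + 2k`. So `j` is `2k`, and `-2n + 3`
  -- equals `-(1 + 2k)`.
  open Crowns 1 (suc (2 ℕ.* k))
  largest : - (+ 2 * + suc (suc k)) + + 3 ≡ -[1+ 2 ℕ.* k ]
  largest = cong (λ z → - z + + 3) (trans (sym (ℤ.pos-* 2 (2 ℕ.+ k))) (cong +_ (*-distribˡ-+ 2 2 k)))
  realize : ∀ {m} {G : Graph (suc m)} → Labelled G (const ⊤) → Even m → ∃[ m ] Σ[ G ∈ Graph m ]
    UpperGameVertexCritical G ×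
    (λ (d : ℤ) → ∃[ x ] d ≡ + χ G - + χ (G -ᵛ x))
    ≐ (｛ -1ℤ ｝ ∪ ｛ - (+ 2 * + suc (suc k)) + + 3 ｝)
  realize L even = _ , _ , crowns-of-size-3-and-3+ (2 ℕ.* k) L even largest
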